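{- For every nonnegative integer $n$, $$\sum_{k=0}^{\infty}(-1)^k(4k+1)\,\frac{(-n)_k^2\,(\tfrac12)_k}{k!\,(n+\tfrac32)_k^2}=\left(\frac14\right)^n\frac{(\tfrac32)_n^2}{(\tfrac54)_n(\tfrac34)_n}.$$ (The sum is finite, since $(-n)_k=0$ for $k>n$.)
   Context: $(a)_j=\Gamma(a+j)/\Gamma(a)=a(a+1)\cdots(a+j-1)$ denotes the rising factorial (Pochhammer symbol), with $(a)_0=1$. -}

module Defs where

import Algebra.Definitions.RawSemiring as RawSemiring
open import Data.Fin.Base using (toℕ)
open import Data.Integer.Base using (+_)
open import Data.Nat.Base as ℕ using (ℕ; zero; suc)
import Data.Nat.Properties as ℕ
open import Data.Product.Base using (∃-syntax; _×_)
open import Data.Rational.Base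
open import Data.Rational.Properties
open import Relation.Binary.PropositionalEquality using (_≡_)

open RawSemiring +-*-rawSemiring public using (_^_; sum)

infix 9 ⟦_⟧

⟦_⟧ : ℕ → ℚ
⟦ n ⟧ = + n / 1

-- The rising factorial (a)_j = a(a+1)⋯(a+j-1).
poch : ℚ → ℕ → ℚ
poch a zero    = 1ℚ
poch a (suc j) = poch a j * (a + ⟦ j ⟧)

-- The series Σ_{k≥0} f k has only finitely many nonzero terms, and these
-- add up to s; the choice of the bound N is immaterial.
HasFiniteSum : (ℕ → ℚ) → ℚ → Set
HasFiniteSum f s =
  ∃[ N ] (∀ k → N ℕ.≤ k → f k ≡ 0ℚ) × sum {N} (λ i → f (toℕ i)) ≡ s

⟦⟧-nonNeg : ∀ n → NonNegative ⟦ n ⟧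
⟦⟧-nonNeg n = normalize-nonNeg n 1

⟦!⟧-pos : ∀ k → Positive ⟦ k ℕ.! ⟧
⟦!⟧-pos k = normalize-pos (k ℕ.!) 1 {{_}} {{k ℕ.!≢0}}

poch-pos : ∀ a j → .{{Positive a}} → Positive (poch a j)
poch-pos a zero    = _
poch-pos a (suc j) =
  pos*pos⇒pos (poch a j) {{poch-pos a j}}
    (a + ⟦ j ⟧) {{pos+nonNeg⇒pos a ⟦ j ⟧ {{⟦⟧-nonNeg j}}}}

^-pos : ∀ p j → .{{Positive p}} → Positive (p ^ j)
^-pos p zero    = _
^-pos p (suc j) = pos*pos⇒pos p (p ^ j) {{^-pos p j}}

lhs-denominator≢0 : ∀ n k →
  NonZero (⟦ k ℕ.! ⟧ * poch (⟦ n ⟧ + + 3 / 2) k ^ 2)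
lhs-denominator≢0 n k =
  pos⇒nonZero (⟦ k ℕ.! ⟧ * c ^ 2)
    {{pos*pos⇒pos ⟦ k ℕ.! ⟧ {{⟦!⟧-pos k}} (c ^ 2) {{^-pos c 2 {{c-pos}}}}}}
  where
  c = poch (⟦ n ⟧ + + 3 / 2) k
  c-pos : Positive c
  c-pos = poch-pos (⟦ n ⟧ + + 3 / 2) k
            {{nonNeg+pos⇒pos ⟦ n ⟧ {{⟦⟧-nonNeg n}} (+ 3 / 2)}}

rhs-denominator≢0 : ∀ n → NonZero (poch (+ 5 / 4) n * poch (+ 3 / 4) n)
rhs-denominator≢0 n =
  pos⇒nonZero (a * b)
    {{pos*pos⇒pos a {{poch-pos (+ 5 / 4) n}} b {{poch-pos (+ 3 / 4) n}}}}
  where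
  a = poch (+ 5 / 4) n
  b = poch (+ 3 / 4) n

{-# OPTIONS --safe #-}

-- The series is the case a = 1/2, m = n of the well-poised sum
--   Σ_k (a + 2k) t n k = a (1 + a)_n / (m + 1 + a)_n,   where
--   t n k = (-1)^k (a)_k (-n)_k (-m)_k / (k! (n + 1 + a)_k (m + 1 + a)_k).
-- With m fixed, creative telescoping in k (a WZ certificate) gives
--   (m + 1 + a + n) S (n + 1) = (n + 1 + a) S n
-- for the left-hand side S n, since the certificate vanishes at k = 0 and
-- k = n + 2. The duplication formula for (3/2)_{2n} then
-- brings (3/2)_n / (n + 3/2)_n to the stated form.

module Submission where

open import Defs
open import Algebra.Bundles using (module CommutativeRing)
import Algebra.Properties.Semiring.Sum as SemiringSum
open import Data.Fin.Base using (toℕ)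
open import Data.Integer.Base as ℤ using (+_)
import Data.Integer.Properties as ℤ
open import Data.Nat.Base as ℕ using (ℕ; zero; suc; _!)
import Data.Nat.Coprimality as Coprimality
import Data.Nat.Properties as ℕ
open import Data.Product.Base using (_,_)
open import Data.Rational.Base using (ℚ; mkℚ; 0ℚ; 1ℚ; ½; _+_; _*_; _-_; -_; 1/_; _/_; _÷_; NonZero; Positive; NonNegative)
open import Data.Rational.Properties
open import Data.Rational.Solver using (module +-*-Solver)
open import Data.Sum.Base using (inj₁; inj₂)
open import Relation.Binary.PropositionalEquality

open SemiringSum (CommutativeRing.semiring +-*-commutativeRing) using (sum-cong-≗; ∑-distrib-+; *-distribˡ-sum)
open +-*-Solver using (solve; con; _:=_; _:+_; _:*_; _:-_; :-_)
open ≡-Reasoning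

-- Natural numbers and division inside the rationals.

-- The gcd inside `_/_` is stuck for a variable `n`. In `mkℚ` form numerator and denominator are
-- visible, so sums and products unfold to integer arithmetic.
⟦⟧≡mkℚ : ∀ n → ⟦ n ⟧ ≡ mkℚ (+ n) 0 (Coprimality.sym (Coprimality.1-coprimeTo n))
⟦⟧≡mkℚ n = normalize-coprime (Coprimality.sym (Coprimality.1-coprimeTo n))

⟦⟧-homo-+ : ∀ m n → ⟦ m ℕ.+ n ⟧ ≡ ⟦ m ⟧ + ⟦ n ⟧
⟦⟧-homo-+ m n rewrite ⟦⟧≡mkℚ m | ⟦⟧≡mkℚ n =
  cong (_/ 1) (sym (cong₂ ℤ._+_ (ℤ.*-identityʳ (+ m)) (ℤ.*-identityʳ (+ n))))

⟦⟧-homo-* : ∀ m n → ⟦ m ℕ.* n ⟧ ≡ ⟦ m ⟧ * ⟦ n ⟧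
⟦⟧-homo-* m n rewrite ⟦⟧≡mkℚ m | ⟦⟧≡mkℚ n = cong (_/ 1) (ℤ.pos-* m n)

⟦suc⟧ : ∀ n → ⟦ suc n ⟧ ≡ 1ℚ + ⟦ n ⟧
⟦suc⟧ = ⟦⟧-homo-+ 1

÷-*-cancel : ∀ p q .{{_ : NonZero q}} → (p ÷ q) * q ≡ p
÷-*-cancel p q = begin
  p * (1/ q) * q   ≡⟨ *-assoc p (1/ q) q ⟩
  p * ((1/ q) * q) ≡⟨ cong (p *_) (*-inverseˡ q) ⟩
  p * 1ℚ           ≡⟨ *-identityʳ p ⟩
  p                ∎

*-cancelʳ-≡ : ∀ p q r .{{_ : NonZero r}} → p * r ≡ q * r → p ≡ q
*-cancelʳ-≡ p q r pr≡qr = begin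
  p              ≡⟨ expand p ⟩
  p * r * (1/ r) ≡⟨ cong (_* (1/ r)) pr≡qr ⟩
  q * r * (1/ r) ≡⟨ expand q ⟨
  q              ∎
  where
  expand : ∀ x → x ≡ x * r * (1/ r)
  expand x = sym (trans (*-assoc x r (1/ r)) (trans (cong (x *_) (*-inverseʳ r)) (*-identityʳ x)))

0÷ : ∀ {p} q .{{_ : NonZero q}} → p ≡ 0ℚ → p ÷ q ≡ 0ℚ
0÷ q refl = *-zeroˡ (1/ q)

-- Finite sums and telescoping.

∑ : ℕ → (ℕ → ℚ) → ℚ
∑ N f = sum {N} (λ i → f (toℕ i))

∑-cong : ∀ N {f g : ℕ → ℚ} → (∀ k → f k ≡ g k) → ∑ N f ≡ ∑ N g
∑-cong N f≗g = sum-cong-≗ {N} (λ i → f≗g (toℕ i))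

∑-*ˡ : ∀ N p f → ∑ N (λ k → p * f k) ≡ p * ∑ N f
∑-*ˡ N p f = sym (*-distribˡ-sum {N} p (λ i → f (toℕ i)))

∑-linear : ∀ N p q f g → ∑ N (λ k → p * f k + q * g k) ≡ p * ∑ N f + q * ∑ N g
∑-linear N p q f g =
  trans (∑-distrib-+ {N} (λ i → p * f (toℕ i)) (λ i → q * g (toℕ i)))
        (cong₂ _+_ (∑-*ˡ N p f) (∑-*ˡ N q g))

-- `sum` unfolds at its first index, whereas telescoping and dropping a vanishing final term both
-- work at the last one.
∑-last : ∀ N f → ∑ (suc N) f ≡ ∑ N f + f N
∑-last zero    f = +-comm (f 0) 0ℚ
∑-last (suc N) f =
  trans (cong (λ s → f 0 + s) (∑-last N (λ k → f (suc k)))) (sym (+-assoc (f 0) _ _))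

∑-telescope : ∀ N (f g : ℕ → ℚ) → (∀ k → f k ≡ g (suc k) - g k) → ∑ N f ≡ g N - g 0
∑-telescope zero    f g eq = sym (+-inverseʳ (g 0))
∑-telescope (suc N) f g eq = begin
  ∑ (suc N) f          ≡⟨ ∑-last N f ⟩
  ∑ N f + f N          ≡⟨ cong₂ _+_ (∑-telescope N f g eq) (eq N) ⟩
  g N - g 0 + (g (suc N) - g N)
    ≡⟨ solve 3 (λ x y z → x :- y :+ (z :- x) := z :- y) refl (g N) (g 0) (g (suc N)) ⟩
  g (suc N) - g 0      ∎

-- Rising factorials.

-- `poch` grows at its last factor; splitting off the first one instead relates the symbols based at
-- `x` and at `1ℚ + x`.
poch-head : ∀ x k → poch x (suc k) ≡ x * poch (1ℚ + x) k
poch-head x zero    = solve 1 (λ x → con 1ℚ :* (x :+ con 0ℚ) := x :* con 1ℚ) refl x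
poch-head x (suc k) = begin
  poch x (suc k) * (x + ⟦ suc k ⟧)
    ≡⟨ cong₂ (λ p q → p * (x + q)) (poch-head x k) (⟦suc⟧ k) ⟩
  x * poch (1ℚ + x) k * (x + (1ℚ + ⟦ k ⟧))
    ≡⟨ solve 3 (λ x p k → x :* p :* (x :+ (con 1ℚ :+ k)) := x :* (p :* (con 1ℚ :+ x :+ k)))
         refl x (poch (1ℚ + x) k) ⟦ k ⟧ ⟩
  x * poch (1ℚ + x) (suc k) ∎

-- The factor of index `n` is -n + n = 0; the induction strips later factors until this one is last.
poch-neg-vanishes : ∀ {n k} → n ℕ.< k → poch (- ⟦ n ⟧) k ≡ 0ℚ
poch-neg-vanishes {n} {suc k} (ℕ.s≤s n≤k) with ℕ.m≤n⇒m<n∨m≡n n≤k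
... | inj₁ n<k  = trans (cong (_* (- ⟦ n ⟧ + ⟦ k ⟧)) (poch-neg-vanishes n<k)) (*-zeroˡ (- ⟦ n ⟧ + ⟦ k ⟧))
... | inj₂ refl = trans (cong (poch (- ⟦ n ⟧) n *_) (+-inverseˡ ⟦ n ⟧)) (*-zeroʳ (poch (- ⟦ n ⟧) n))

-- This is (x)_n (x + 1/2)_n = 4^(-n) (2x)_{2n}, with (2x)_{2n} split after its first `n` factors.
poch-duplication : ∀ x n →
  poch x n * poch (x + ½) n ≡ (+ 1 / 4) ^ n * (poch (x + x) n * poch (⟦ n ⟧ + (x + x)) n)
poch-duplication x zero    = refl
poch-duplication x (suc n) = begin
  X * (x + N) * (Y * (x + ½ + N))
    ≡⟨ solve 4 (λ x n p q → p :* (x :+ n) :* (q :* (x :+ con ½ :+ n))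
                         := p :* q :* ((x :+ n) :* (x :+ con ½ :+ n))) refl x N X Y ⟩
  X * Y * ((x + N) * (x + ½ + N))
    ≡⟨ cong (_* ((x + N) * (x + ½ + N))) (poch-duplication x n) ⟩
  Q * (Z * W) * ((x + N) * (x + ½ + N))
    -- The two new factors satisfy (x + n)(x + 1/2 + n) = (1/4)(2x + 2n)(2x + 2n + 1).
    ≡⟨ solve 5 (λ x n q z w →
          q :* (z :* w) :* ((x :+ n) :* (x :+ con ½ :+ n))
          := con (+ 1 / 4) :* q :* (z :* (w :* (n :+ (x :+ x) :+ n)) :* (con 1ℚ :+ n :+ (x :+ x) :+ n)))
         refl x N Q Z W ⟩
  (+ 1 / 4) * Q * (Z * (W * (y + N)) * (1ℚ + N + (x + x) + N))
    -- The split point moves from `n` to `n + 1`: the first factor `y` of the second half becomes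
    -- the last factor of the first half.
    ≡⟨ cong (λ p → (+ 1 / 4) * Q * (Z * p * (1ℚ + N + (x + x) + N))) (poch-head y n) ⟩
  (+ 1 / 4) * Q * (Z * (y * V) * (1ℚ + N + (x + x) + N))
    ≡⟨ solve 5 (λ x n q z v →
          con (+ 1 / 4) :* q :* (z :* ((n :+ (x :+ x)) :* v) :* (con 1ℚ :+ n :+ (x :+ x) :+ n))
          := con (+ 1 / 4) :* q :* (z :* (x :+ x :+ n) :* (v :* (con 1ℚ :+ (n :+ (x :+ x)) :+ n))))
         refl x N Q Z V ⟩
  (+ 1 / 4) * Q * (Z * (x + x + N) * (V * (1ℚ + y + N)))
    ≡⟨ cong (λ p → (+ 1 / 4) * Q * (Z * (x + x + N) * (poch p n * (p + N)))) (+-assoc 1ℚ N (x + x)) ⟨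
  (+ 1 / 4) * Q * (Z * (x + x + N) * (poch (1ℚ + N + (x + x)) n * (1ℚ + N + (x + x) + N)))
    ≡⟨ cong (λ p → (+ 1 / 4) * Q * (Z * (x + x + N) * (poch (p + (x + x)) n * (p + (x + x) + N)))) (⟦suc⟧ n) ⟨
  (+ 1 / 4) ^ suc n * (poch (x + x) (suc n) * poch (⟦ suc n ⟧ + (x + x)) (suc n)) ∎
  where
  N = ⟦ n ⟧
  y = N + (x + x)
  X = poch x n
  Y = poch (x + ½) n
  Q = (+ 1 / 4) ^ n
  Z = poch (x + x) n
  W = poch y n
  V = poch (1ℚ + y) n

-- Terms of the well-poised sum and their ratios.

module WellPoised (a m : ℚ) .{{_ : Positive a}} .{{_ : NonNegative m}} where

  -- `m` is independent of `n` although the theorem sets them equal: with `m` fixed, a step in `n`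
  -- changes only one upper and one lower parameter.
  numerator : ℕ → ℕ → ℚ
  numerator n k = (- 1ℚ) ^ k * (poch a k * (poch (- ⟦ n ⟧) k * poch (- m) k))

  denominator : ℕ → ℕ → ℚ
  denominator n k = ⟦ k ! ⟧ * (poch (⟦ n ⟧ + (1ℚ + a)) k * poch (m + (1ℚ + a)) k)

  shift-pos : ∀ p → .{{NonNegative p}} → Positive (p + (1ℚ + a))
  shift-pos p = nonNeg+pos⇒pos p (1ℚ + a) {{pos+pos⇒pos 1ℚ a}}

  poch-shift-pos : ∀ p k → .{{NonNegative p}} → Positive (poch (p + (1ℚ + a)) k)
  poch-shift-pos p k = poch-pos (p + (1ℚ + a)) k {{shift-pos p}}

  denominator≢0 : ∀ n k → NonZero (denominator n k)
  denominator≢0 n k = pos⇒nonZero (denominator n k)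
    {{pos*pos⇒pos ⟦ k ! ⟧ {{⟦!⟧-pos k}} (u * v)
      {{pos*pos⇒pos u {{poch-shift-pos ⟦ n ⟧ k {{⟦⟧-nonNeg n}}}} v {{poch-shift-pos m k}}}}}}
    where
    u = poch (⟦ n ⟧ + (1ℚ + a)) k
    v = poch (m + (1ℚ + a)) k

  term : ℕ → ℕ → ℚ
  term n k = _÷_ (numerator n k) (denominator n k) {{denominator≢0 n k}}

  term*denominator : ∀ n k → term n k * denominator n k ≡ numerator n k
  term*denominator n k = ÷-*-cancel (numerator n k) (denominator n k) {{denominator≢0 n k}}

  numerator-vanishes : ∀ {n k} → n ℕ.< k → numerator n k ≡ 0ℚ
  numerator-vanishes {n} {k} n<k = begin
    (- 1ℚ) ^ k * (poch a k * (poch (- ⟦ n ⟧) k * poch (- m) k))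
      ≡⟨ cong (λ p → (- 1ℚ) ^ k * (poch a k * (p * poch (- m) k))) (poch-neg-vanishes n<k) ⟩
    (- 1ℚ) ^ k * (poch a k * (0ℚ * poch (- m) k))
      ≡⟨ solve 3 (λ s x y → s :* (x :* (con 0ℚ :* y)) := con 0ℚ) refl
           ((- 1ℚ) ^ k) (poch a k) (poch (- m) k) ⟩
    0ℚ ∎

  term-vanishes : ∀ {n k} → n ℕ.< k → term n k ≡ 0ℚ
  term-vanishes {n} {k} n<k = 0÷ (denominator n k) {{denominator≢0 n k}} (numerator-vanishes n<k)

  -- Each rising factorial and the factorial gain one factor, and (-1)^k changes sign. Multiplying
  -- by `denominator n k` completes `denominator n (suc k)` on the left.
  term-sucʳ : ∀ n k →
    term n (suc k) * ((1ℚ + ⟦ k ⟧) * ((⟦ n ⟧ + (1ℚ + a) + ⟦ k ⟧) * (m + (1ℚ + a) + ⟦ k ⟧)))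
      ≡ - (term n k * ((a + ⟦ k ⟧) * ((- ⟦ n ⟧ + ⟦ k ⟧) * (- m + ⟦ k ⟧))))
  term-sucʳ n k = *-cancelʳ-≡ _ _ (denominator n k) {{denominator≢0 n k}} (begin
    t' * (δ₀ * (δ₁ * δ₂)) * (F * (U * V))
      ≡⟨ solve 7 (λ t x y z f u v → t :* (x :* (y :* z)) :* (f :* (u :* v))
                                 := t :* (x :* f :* (u :* y :* (v :* z)))) refl t' δ₀ δ₁ δ₂ F U V ⟩
    t' * (δ₀ * F * (U * δ₁ * (V * δ₂)))
      ≡⟨ cong (λ f → t' * (f * (U * δ₁ * (V * δ₂)))) !-suc ⟨
    t' * denominator n (suc k)
      ≡⟨ term*denominator n (suc k) ⟩
    - 1ℚ * s * (A * ν₀ * (B * ν₁ * (C * ν₂)))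
      ≡⟨ solve 7 (λ s x y z f u v → con (- 1ℚ) :* s :* (f :* x :* (u :* y :* (v :* z)))
                                 := :- (s :* (f :* (u :* v)) :* (x :* (y :* z)))) refl s ν₀ ν₁ ν₂ A B C ⟩
    - (numerator n k * (ν₀ * (ν₁ * ν₂)))
      ≡⟨ cong (λ p → - (p * (ν₀ * (ν₁ * ν₂)))) (term*denominator n k) ⟨
    - (t * denominator n k * (ν₀ * (ν₁ * ν₂)))
      ≡⟨ solve 3 (λ t d ν → :- (t :* d :* ν) := :- (t :* ν) :* d) refl t (denominator n k) (ν₀ * (ν₁ * ν₂)) ⟩
    - (t * (ν₀ * (ν₁ * ν₂))) * denominator n k ∎)
    where
    t = term n k
    t' = term n (suc k)
    s = (- 1ℚ) ^ k
    A = poch a k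
    B = poch (- ⟦ n ⟧) k
    C = poch (- m) k
    F = ⟦ k ! ⟧
    U = poch (⟦ n ⟧ + (1ℚ + a)) k
    V = poch (m + (1ℚ + a)) k
    δ₀ = 1ℚ + ⟦ k ⟧
    δ₁ = ⟦ n ⟧ + (1ℚ + a) + ⟦ k ⟧
    δ₂ = m + (1ℚ + a) + ⟦ k ⟧
    ν₀ = a + ⟦ k ⟧
    ν₁ = - ⟦ n ⟧ + ⟦ k ⟧
    ν₂ = - m + ⟦ k ⟧
    !-suc : ⟦ suc k ! ⟧ ≡ δ₀ * F
    !-suc = trans (⟦⟧-homo-* (suc k) (k !)) (cong (_* F) (⟦suc⟧ k))

  -- Only (-n)_k and (n + 1 + a)_k depend on `n`, and both shift their base by one. The ratio is
  -- cross-multiplied because 1 + n - k vanishes at k = n + 1.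
  term-sucˡ : ∀ n k →
    term (suc n) k * ((1ℚ + ⟦ n ⟧ - ⟦ k ⟧) * (⟦ n ⟧ + (1ℚ + a) + ⟦ k ⟧))
      ≡ term n k * ((1ℚ + ⟦ n ⟧) * (⟦ n ⟧ + (1ℚ + a)))
  term-sucˡ n k =
    *-cancelʳ-≡ _ _ (denominator (suc n) k) {{denominator≢0 (suc n) k}}
      (*-cancelʳ-≡ _ _ (denominator n k) {{denominator≢0 n k}} (begin
    t' * ((1ℚ + N - K) * (u + K)) * D' * D
      ≡⟨ solve 4 (λ t r d' d → t :* r :* d' :* d := t :* d' :* r :* d) refl t' ((1ℚ + N - K) * (u + K)) D' D ⟩
    t' * D' * ((1ℚ + N - K) * (u + K)) * D
      ≡⟨ cong (λ p → p * ((1ℚ + N - K) * (u + K)) * D) (term*denominator (suc n) k) ⟩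
    s * (A * (B' * C)) * ((1ℚ + N - K) * (u + K)) * (F * (U * V))
      -- Up to sign, 1 + n - k is the missing last factor of (-(n + 1))_{k+1}, and u + k is that of
      -- (u)_{k+1}; `B-eq` and `U-eq` then split off the first factors instead.
      ≡⟨ solve 10 (λ n k u s a b c f w v →
           s :* (a :* (b :* c)) :* ((con 1ℚ :+ n :- k) :* (u :+ k)) :* (f :* (w :* v))
           := :- (s :* (a :* (b :* (:- (con 1ℚ :+ n) :+ k) :* c))) :* (f :* (w :* (u :+ k) :* v)))
           refl N K u s A B' C F U V ⟩
    - (s * (A * (B' * (- (1ℚ + N) + K) * C))) * (F * (U * (u + K) * V))
      ≡⟨ cong₂ (λ p q → - (s * (A * (p * C))) * (F * (q * V))) B-eq U-eq ⟩
    - (s * (A * (- (1ℚ + N) * B * C))) * (F * (u * U' * V))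
      ≡⟨ solve 9 (λ n u s a b c f w v →
           :- (s :* (a :* (:- (con 1ℚ :+ n) :* b :* c))) :* (f :* (u :* w :* v))
           := s :* (a :* (b :* c)) :* ((con 1ℚ :+ n) :* u) :* (f :* (w :* v)))
           refl N u s A B C F U' V ⟩
    s * (A * (B * C)) * ((1ℚ + N) * u) * D'
      ≡⟨ cong (λ p → p * ((1ℚ + N) * u) * D') (term*denominator n k) ⟨
    t * D * ((1ℚ + N) * u) * D'
      ≡⟨ solve 4 (λ t r d' d → t :* d :* r :* d' := t :* r :* d' :* d) refl t ((1ℚ + N) * u) D' D ⟩
    t * ((1ℚ + N) * u) * D' * D ∎))
    where
    N = ⟦ n ⟧
    K = ⟦ k ⟧
    t = term n k
    t' = term (suc n) k
    D = denominator n k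
    D' = denominator (suc n) k
    s = (- 1ℚ) ^ k
    A = poch a k
    B = poch (- N) k
    B' = poch (- ⟦ suc n ⟧) k
    C = poch (- m) k
    F = ⟦ k ! ⟧
    u = N + (1ℚ + a)
    U = poch u k
    U' = poch (⟦ suc n ⟧ + (1ℚ + a)) k
    V = poch (m + (1ℚ + a)) k
    B-eq : B' * (- (1ℚ + N) + K) ≡ - (1ℚ + N) * B
    B-eq = begin
      B' * (- (1ℚ + N) + K)
        ≡⟨ cong (λ x → poch (- x) k * (- (1ℚ + N) + K)) (⟦suc⟧ n) ⟩
      poch (- (1ℚ + N)) (suc k)
        ≡⟨ poch-head (- (1ℚ + N)) k ⟩
      - (1ℚ + N) * poch (1ℚ + - (1ℚ + N)) k
        ≡⟨ cong (λ x → - (1ℚ + N) * poch x k)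
             (solve 1 (λ n → con 1ℚ :+ :- (con 1ℚ :+ n) := :- n) refl N) ⟩
      - (1ℚ + N) * B ∎
    U-eq : U * (u + K) ≡ u * U'
    U-eq = begin
      poch u (suc k) ≡⟨ poch-head u k ⟩
      u * poch (1ℚ + u) k
        ≡⟨ cong (λ x → u * poch x k) (trans (sym (+-assoc 1ℚ N (1ℚ + a))) (cong (_+ (1ℚ + a)) (sym (⟦suc⟧ n)))) ⟩
      u * U' ∎

  -- Creative telescoping and the closed form.

  weighted : ℕ → ℕ → ℚ
  weighted n k = (a + (⟦ k ⟧ + ⟦ k ⟧)) * term n k

  partialSum : ℕ → ℚ
  partialSum n = ∑ (suc n) (weighted n)

  -- A polynomial multiple of `term (suc n) k`; written over `term n k` it would have the
  -- denominator 1 + n - k. At k + 1 its polynomial factor is exactly the one cleared by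
  -- `term-sucʳ`.
  certificate : ℕ → ℕ → ℚ
  certificate n k = - (term (suc n) k * (⟦ k ⟧ * ((⟦ n ⟧ + (1ℚ + a) + ⟦ k ⟧) * (m + a + ⟦ k ⟧))))

  -- Both ratios bring everything to `term (suc n) k` times a polynomial. The common factor 1 + n in
  -- the coefficients comes from `term-sucˡ`.
  certificate-Δ : ∀ n k →
    (1ℚ + ⟦ n ⟧) * (m + (1ℚ + a) + ⟦ n ⟧) * weighted (suc n) k
      + - ((1ℚ + ⟦ n ⟧) * (⟦ n ⟧ + (1ℚ + a))) * weighted n k
      ≡ certificate n (suc k) - certificate n k
  certificate-Δ n k = begin
    (1ℚ + N) * (m + (1ℚ + a) + N) * (w * t') + - ((1ℚ + N) * (N + (1ℚ + a))) * (w * t)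
      ≡⟨ solve 5 (λ n m a w' t →
           (con 1ℚ :+ n) :* (m :+ (con 1ℚ :+ a) :+ n) :* w' :+ :- ((con 1ℚ :+ n) :* (n :+ (con 1ℚ :+ a))) :* t
           := (con 1ℚ :+ n) :* (m :+ (con 1ℚ :+ a) :+ n) :* w' :- t :* ((con 1ℚ :+ n) :* (n :+ (con 1ℚ :+ a))))
           refl N m a (w * t') (w * t) ⟩
    (1ℚ + N) * (m + (1ℚ + a) + N) * (w * t') - w * t * ((1ℚ + N) * (N + (1ℚ + a)))
      ≡⟨ cong (λ p → (1ℚ + N) * (m + (1ℚ + a) + N) * (w * t') - p)
           (trans (*-assoc w t _) (cong (w *_) (sym (term-sucˡ n k)))) ⟩
    (1ℚ + N) * (m + (1ℚ + a) + N) * (w * t') - w * (t' * ((1ℚ + N - K) * (N + (1ℚ + a) + K)))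
      -- The heart of the certificate: (a + 2k)((n+1)(m+1+a+n) - (n+1-k)(n+1+a+k)) =
      -- (a+k)(k-n-1)(k-m) + k(n+1+a+k)(m+a+k).
      ≡⟨ solve 5 (λ n m a k t →
           (con 1ℚ :+ n) :* (m :+ (con 1ℚ :+ a) :+ n) :* ((a :+ (k :+ k)) :* t)
             :- (a :+ (k :+ k)) :* (t :* ((con 1ℚ :+ n :- k) :* (n :+ (con 1ℚ :+ a) :+ k)))
           := t :* ((a :+ k) :* ((:- (con 1ℚ :+ n) :+ k) :* (:- m :+ k)))
             :- :- (t :* (k :* ((n :+ (con 1ℚ :+ a) :+ k) :* (m :+ a :+ k)))))
           refl N m a K t' ⟩
    t' * ((a + K) * ((- (1ℚ + N) + K) * (- m + K))) - certificate n k
      ≡⟨ cong (_- certificate n k) head ⟨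
    certificate n (suc k) - certificate n k ∎
    where
    N = ⟦ n ⟧
    K = ⟦ k ⟧
    w = a + (K + K)
    t = term n k
    t' = term (suc n) k
    t'' = term (suc n) (suc k)
    head : certificate n (suc k) ≡ t' * ((a + K) * ((- (1ℚ + N) + K) * (- m + K)))
    head = begin
      - (t'' * (⟦ suc k ⟧ * ((N + (1ℚ + a) + ⟦ suc k ⟧) * (m + a + ⟦ suc k ⟧))))
        ≡⟨ cong (λ x → - (t'' * (x * ((N + (1ℚ + a) + x) * (m + a + x))))) (⟦suc⟧ k) ⟩
      - (t'' * ((1ℚ + K) * ((N + (1ℚ + a) + (1ℚ + K)) * (m + a + (1ℚ + K)))))
        ≡⟨ solve 5 (λ n m a k t →
             :- (t :* ((con 1ℚ :+ k) :* ((n :+ (con 1ℚ :+ a) :+ (con 1ℚ :+ k)) :* (m :+ a :+ (con 1ℚ :+ k)))))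
             := :- (t :* ((con 1ℚ :+ k) :* ((con 1ℚ :+ n :+ (con 1ℚ :+ a) :+ k) :* (m :+ (con 1ℚ :+ a) :+ k)))))
             refl N m a K t'' ⟩
      - (t'' * ((1ℚ + K) * ((1ℚ + N + (1ℚ + a) + K) * (m + (1ℚ + a) + K))))
        -- The substitution turns `⟦ suc n ⟧` in the ratio into `1ℚ + N`, matching the polynomial
        -- form.
        ≡⟨ cong -_ (subst
             (λ x → t'' * ((1ℚ + K) * ((x + (1ℚ + a) + K) * (m + (1ℚ + a) + K)))
                    ≡ - (t' * ((a + K) * ((- x + K) * (- m + K)))))
             (⟦suc⟧ n) (term-sucʳ (suc n) k)) ⟩
      - - (t' * ((a + K) * ((- (1ℚ + N) + K) * (- m + K))))
        ≡⟨ solve 1 (λ x → :- (:- x) := x) refl (t' * ((a + K) * ((- (1ℚ + N) + K) * (- m + K)))) ⟩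
      t' * ((a + K) * ((- (1ℚ + N) + K) * (- m + K))) ∎

  certificate-zero : ∀ n → certificate n 0 ≡ 0ℚ
  certificate-zero n =
    solve 3 (λ t x y → :- (t :* (con 0ℚ :* (x :* y))) := con 0ℚ) refl
      (term (suc n) 0) (⟦ n ⟧ + (1ℚ + a) + 0ℚ) (m + a + 0ℚ)

  certificate-vanishes : ∀ n → certificate n (suc (suc n)) ≡ 0ℚ
  certificate-vanishes n =
    trans (cong (λ t → - (t * r)) (term-vanishes (ℕ.n<1+n (suc n))))
          (solve 1 (λ r → :- (con 0ℚ :* r) := con 0ℚ) refl r)
    where
    r = ⟦ suc (suc n) ⟧ * ((⟦ n ⟧ + (1ℚ + a) + ⟦ suc (suc n) ⟧) * (m + a + ⟦ suc (suc n) ⟧))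

  -- Padding with the zero term k = n + 1 gives the sums for `n` and `suc n` a common range.
  ∑-weighted-suc : ∀ n → ∑ (suc (suc n)) (weighted n) ≡ partialSum n
  ∑-weighted-suc n = begin
    ∑ (suc (suc n)) (weighted n)          ≡⟨ ∑-last (suc n) (weighted n) ⟩
    partialSum n + w * term n (suc n)     ≡⟨ cong (λ t → partialSum n + w * t) (term-vanishes (ℕ.n<1+n n)) ⟩
    partialSum n + w * 0ℚ                 ≡⟨ solve 2 (λ s w → s :+ w :* con 0ℚ := s) refl (partialSum n) w ⟩
    partialSum n                          ∎
    where w = a + (⟦ suc n ⟧ + ⟦ suc n ⟧)

  -- Summing `certificate-Δ` over k = 0, ..., n + 1 leaves two boundary values, both zero; the
  -- nonzero factor 1 + n is then cancelled.
  partialSum-suc : ∀ n →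
    partialSum (suc n) * (m + (1ℚ + a) + ⟦ n ⟧) ≡ partialSum n * (1ℚ + a + ⟦ n ⟧)
  partialSum-suc n = *-cancelʳ-≡ _ _ (1ℚ + N) {{nonZero}} (begin
    S' * (m + (1ℚ + a) + N) * (1ℚ + N)
      ≡⟨ solve 5 (λ n m a s s' →
           s' :* (m :+ (con 1ℚ :+ a) :+ n) :* (con 1ℚ :+ n)
           := (con 1ℚ :+ n) :* (m :+ (con 1ℚ :+ a) :+ n) :* s'
              :+ :- ((con 1ℚ :+ n) :* (n :+ (con 1ℚ :+ a))) :* s
              :+ s :* (con 1ℚ :+ a :+ n) :* (con 1ℚ :+ n))
           refl N m a S S' ⟩
    p * S' + q * S + S * (1ℚ + a + N) * (1ℚ + N)
      ≡⟨ cong (_+ S * (1ℚ + a + N) * (1ℚ + N)) vanishing ⟩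
    0ℚ + S * (1ℚ + a + N) * (1ℚ + N)
      ≡⟨ +-identityˡ _ ⟩
    S * (1ℚ + a + N) * (1ℚ + N) ∎)
    where
    N = ⟦ n ⟧
    S = partialSum n
    S' = partialSum (suc n)
    p = (1ℚ + N) * (m + (1ℚ + a) + N)
    q = - ((1ℚ + N) * (N + (1ℚ + a)))
    nonZero : NonZero (1ℚ + N)
    nonZero = pos⇒nonZero (1ℚ + N) {{pos+nonNeg⇒pos 1ℚ N {{⟦⟧-nonNeg n}}}}
    vanishing : p * S' + q * S ≡ 0ℚ
    vanishing = begin
      p * S' + q * S
        ≡⟨ cong (λ s → p * S' + q * s) (∑-weighted-suc n) ⟨
      p * S' + q * ∑ (suc (suc n)) (weighted n)
        ≡⟨ ∑-linear (suc (suc n)) p q (weighted (suc n)) (weighted n) ⟨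
      ∑ (suc (suc n)) (λ k → p * weighted (suc n) k + q * weighted n k)
        ≡⟨ ∑-telescope (suc (suc n)) _ (certificate n) (certificate-Δ n) ⟩
      certificate n (suc (suc n)) - certificate n 0
        ≡⟨ cong₂ _-_ (certificate-vanishes n) (certificate-zero n) ⟩
      0ℚ ∎

  partialSum-closed : ∀ n →
    partialSum n * poch (m + (1ℚ + a)) n ≡ a * poch (1ℚ + a) n
  partialSum-closed zero    =
    -- `term 0 0` computes to 1, so the only summand is `a`.
    solve 1 (λ a → ((a :+ (con 0ℚ :+ con 0ℚ)) :* con 1ℚ :+ con 0ℚ) :* con 1ℚ := a :* con 1ℚ) refl a
  partialSum-closed (suc n) = begin
    S' * (P * (m + (1ℚ + a) + N))
      ≡⟨ solve 3 (λ s p x → s :* (p :* x) := s :* x :* p) refl S' P (m + (1ℚ + a) + N) ⟩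
    S' * (m + (1ℚ + a) + N) * P
      ≡⟨ cong (_* P) (partialSum-suc n) ⟩
    S * (1ℚ + a + N) * P
      ≡⟨ solve 3 (λ s p x → s :* x :* p := s :* p :* x) refl S P (1ℚ + a + N) ⟩
    S * P * (1ℚ + a + N)
      ≡⟨ cong (_* (1ℚ + a + N)) (partialSum-closed n) ⟩
    a * poch (1ℚ + a) n * (1ℚ + a + N)
      ≡⟨ *-assoc a _ _ ⟩
    a * poch (1ℚ + a) (suc n) ∎
    where
    N = ⟦ n ⟧
    S = partialSum n
    S' = partialSum (suc n)
    P = poch (m + (1ℚ + a)) n

-- Specialisation to a = 1/2 and m = n.

theorem1 : ∀ (n : ℕ) →
    HasFiniteSum
    (λ k → (- 1ℚ) ^ k * ⟦ 4 ℕ.* k ℕ.+ 1 ⟧ *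
    _÷_ (poch (- ⟦ n ⟧) k ^ 2 * poch ½ k)
    (⟦ k ! ⟧ * poch (⟦ n ⟧ + + 3 / 2) k ^ 2) {{lhs-denominator≢0 n k}})
    ((+ 1 / 4) ^ n *
    _÷_ (poch (+ 3 / 2) n ^ 2)
    (poch (+ 5 / 4) n * poch (+ 3 / 4) n) {{rhs-denominator≢0 n}})
theorem1 n = suc n , vanishes , total
  where
  instance
    n-nonNeg : NonNegative ⟦ n ⟧
    n-nonNeg = ⟦⟧-nonNeg n

  -- Since `1ℚ + ½` computes to 3/2, both lower parameters become n + 3/2.
  open WellPoised ½ ⟦ n ⟧

  num den f : ℕ → ℚ
  num k = poch (- ⟦ n ⟧) k ^ 2 * poch ½ k
  den k = ⟦ k ! ⟧ * poch (⟦ n ⟧ + + 3 / 2) k ^ 2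
  f k = (- 1ℚ) ^ k * ⟦ 4 ℕ.* k ℕ.+ 1 ⟧ * _÷_ (num k) (den k) {{lhs-denominator≢0 n k}}

  -- 4k + 1 = 2(1/2 + 2k), and the squares arise because the parameters `n` and `m` coincide.
  f≡2*weighted : ∀ k → f k ≡ ⟦ 2 ⟧ * weighted n k
  f≡2*weighted k = *-cancelʳ-≡ _ _ (den k) {{lhs-denominator≢0 n k}} (begin
    s * ⟦ 4 ℕ.* k ℕ.+ 1 ⟧ * r * den k
      ≡⟨ *-assoc (s * ⟦ 4 ℕ.* k ℕ.+ 1 ⟧) r (den k) ⟩
    s * ⟦ 4 ℕ.* k ℕ.+ 1 ⟧ * (r * den k)
      ≡⟨ cong₂ (λ x y → s * x * y) 4k+1 (÷-*-cancel (num k) (den k) {{lhs-denominator≢0 n k}}) ⟩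
    s * (⟦ 4 ⟧ * K + 1ℚ) * (B ^ 2 * A)
      ≡⟨ solve 4 (λ s k b a →
           s :* (con ⟦ 4 ⟧ :* k :+ con 1ℚ) :* ((b :* (b :* con 1ℚ)) :* a)
           := con ⟦ 2 ⟧ :* (con ½ :+ (k :+ k)) :* (s :* (a :* (b :* b)))) refl s K B A ⟩
    ⟦ 2 ⟧ * w * numerator n k
      ≡⟨ cong (⟦ 2 ⟧ * w *_) (term*denominator n k) ⟨
    ⟦ 2 ⟧ * w * (term n k * (F * (C * C)))
      ≡⟨ solve 4 (λ w t f c →
           con ⟦ 2 ⟧ :* w :* (t :* (f :* (c :* c)))
           := con ⟦ 2 ⟧ :* (w :* t) :* (f :* (c :* (c :* con 1ℚ)))) refl w (term n k) F C ⟩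
    ⟦ 2 ⟧ * weighted n k * den k ∎)
    where
    s = (- 1ℚ) ^ k
    r = _÷_ (num k) (den k) {{lhs-denominator≢0 n k}}
    K = ⟦ k ⟧
    A = poch ½ k
    B = poch (- ⟦ n ⟧) k
    C = poch (⟦ n ⟧ + + 3 / 2) k
    F = ⟦ k ! ⟧
    w = ½ + (K + K)
    4k+1 : ⟦ 4 ℕ.* k ℕ.+ 1 ⟧ ≡ ⟦ 4 ⟧ * K + 1ℚ
    4k+1 = trans (⟦⟧-homo-+ (4 ℕ.* k) 1) (cong (_+ 1ℚ) (⟦⟧-homo-* 4 k))

  vanishes : ∀ k → suc n ℕ.≤ k → f k ≡ 0ℚ
  vanishes k n<k = begin
    f k                                           ≡⟨ f≡2*weighted k ⟩
    ⟦ 2 ⟧ * ((½ + (⟦ k ⟧ + ⟦ k ⟧)) * term n k)    ≡⟨ cong (λ t → ⟦ 2 ⟧ * ((½ + (⟦ k ⟧ + ⟦ k ⟧)) * t)) (term-vanishes n<k) ⟩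
    ⟦ 2 ⟧ * ((½ + (⟦ k ⟧ + ⟦ k ⟧)) * 0ℚ)          ≡⟨ cong (⟦ 2 ⟧ *_) (*-zeroʳ (½ + (⟦ k ⟧ + ⟦ k ⟧))) ⟩
    0ℚ                                            ∎

  A = poch (+ 3 / 2) n
  B = poch (+ 5 / 4) n
  C = poch (+ 3 / 4) n
  P = poch (⟦ n ⟧ + + 3 / 2) n
  Q = (+ 1 / 4) ^ n
  S = partialSum n
  E = _÷_ (A ^ 2) (B * C) {{rhs-denominator≢0 n}}

  P≢0 : NonZero P
  P≢0 = pos⇒nonZero P {{poch-shift-pos ⟦ n ⟧ n}}

  total : ∑ (suc n) f ≡ Q * E
  total = trans (∑-cong (suc n) f≡2*weighted) (trans (∑-*ˡ (suc n) ⟦ 2 ⟧ (weighted n))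
    (*-cancelʳ-≡ _ _ (B * C) {{rhs-denominator≢0 n}} (*-cancelʳ-≡ _ _ P {{P≢0}} (begin
      ⟦ 2 ⟧ * S * (B * C) * P
        ≡⟨ solve 4 (λ s b c p → con ⟦ 2 ⟧ :* s :* (b :* c) :* p := con ⟦ 2 ⟧ :* (s :* p) :* (c :* b)) refl S B C P ⟩
      ⟦ 2 ⟧ * (S * P) * (C * B)
        -- Duplication at x = 3/4, where x + 1/2 = 5/4 and 2x = 3/2, yields a second (3/2)_n
        -- together with the same `P` that clears the closed form.
        ≡⟨ cong₂ (λ x y → ⟦ 2 ⟧ * x * y) (partialSum-closed n) (poch-duplication (+ 3 / 4) n) ⟩
      ⟦ 2 ⟧ * (½ * A) * (Q * (A * P))
        ≡⟨ solve 3 (λ a q p → con ⟦ 2 ⟧ :* (con ½ :* a) :* (q :* (a :* p)) := q :* (a :* (a :* con 1ℚ)) :* p)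
             refl A Q P ⟩
      Q * A ^ 2 * P
        ≡⟨ cong (λ x → Q * x * P) (÷-*-cancel (A ^ 2) (B * C) {{rhs-denominator≢0 n}}) ⟨
      Q * (E * (B * C)) * P
        ≡⟨ cong (_* P) (*-assoc Q E (B * C)) ⟨
      Q * E * (B * C) * P ∎))))
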